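{- For $k \in \mathbb{N}$ let $o(k) \in \mathbb{N}_0$ be the smallest $n \in \mathbb{N}_0$ with $2^n - n \ge k$. Then (1) $\{n(F) : F \in \mathcal{UHIT}_{\delta=k}\} = \{n(F) : F \in \mathcal{MU}_{\delta=k}\} = \{n \in \mathbb{N}_0 : n \ge o(k)\}$; (2) $\{c(F) : F \in \mathcal{UHIT}_{\delta=k}\} = \{c(F) : F \in \mathcal{MU}_{\delta=k}\} = \{n \in \mathbb{N} : n \ge o(k) + k\}$.
   Context: Literals come with a fixed-point-free involution $x \mapsto \overline{x}$; variables are positive literals. A clause is a finite set $C$ of literals with $C \cap \overline{C} = \emptyset$; a clause-set is a finite set of clauses. $\mathrm{var}(F)$, $n(F) = |\mathrm{var}(F)|$, $c(F) = |F|$, $\delta(F) = c(F) - n(F)$. $\mathcal{MU}$ is the class of minimally unsatisfiable clause-sets (unsatisfiable, but removing any clause gives a satisfiable clause-set). $F$ is hitting if for all distinct $C, D \in F$, $C \cap \overline{D} \ne \emptyset$; $\mathcal{UHIT}$ is the class of unsatisfiable hitting clause-sets. $\mathcal{C}_{\delta=k} = \{F \in \mathcal{C} : \delta(F) = k\}$. -}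

module Defs where

open import Data.Bool.Base using (Bool; true; not)
open import Data.Fin.Base using (Fin)
open import Data.Integer.Base using (ℤ; +_; _⊖_)
open import Data.List.Base
  using (List; length; map; concatMap; deduplicate; removeAt)
open import Data.List.Membership.Propositional using (_∈_)
open import Data.List.Relation.Binary.BagAndSetEquality using ([_]-Equality; set)
open import Data.List.Relation.Binary.Disjoint.Propositional using (Disjoint)
open import Data.List.Relation.Unary.All using (All)
open import Data.List.Relation.Unary.Any using (Any)
import Data.List.Relation.Unary.Unique.Setoid as UniqueSetoid
open import Data.Nat.Base using (ℕ; zero; suc; _+_; _∸_; _^_; _≤_; z≤n; s≤s)
open import Data.Nat.Properties
  using (_≤?_; ≤-refl; ≤-trans; ≤-reflexive; +-mono-≤; +-suc; +-identityʳ;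
         m≤m+n; m+n≤o⇒m≤o∸n)
open import Data.Product.Base using (∃; _×_; _,_; proj₁; proj₂)
open import Function.Bundles using (_↣_)
open import Level using (0ℓ)
open import Relation.Binary.Bundles using (Setoid)
import Relation.Binary.Construct.On as On
open import Relation.Binary.Definitions using (DecidableEquality)
open import Relation.Binary.PropositionalEquality using (_≡_; cong; sym)
open import Relation.Nullary using (¬_; yes; no; contradiction)
open import Relation.Unary using (Pred; Decidable)

-- An infinite supply of variables; being infinite is witnessed by an embedding
-- of ℕ, which is what makes clause-sets with arbitrarily many variables available.
record Variables : Set₁ where
  field
    Var      : Set
    _≟_      : DecidableEquality Var
    infinite : ℕ ↣ Var

module ClauseSets (𝒱 : Variables) where

  open Variables 𝒱

  data Literal : Set where
    pos neg : Var → Literal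

  comp : Literal → Literal
  comp (pos v) = neg v
  comp (neg v) = pos v

  var : Literal → Var
  var (pos v) = v
  var (neg v) = v

  -- Finite sets of literals are lists considered up to having the same members,
  -- so order and repetitions in `literals` are immaterial.
  record Clause : Set where
    field
      literals   : List Literal
      consistent : Disjoint literals (map comp literals)

  open Clause public

  clauseSetoid : Setoid 0ℓ 0ℓ
  clauseSetoid = On.setoid ([ set ]-Equality Literal) literals

  open Setoid clauseSetoid public using () renaming (_≈_ to _≈ᶜ_)

  -- No two listed clauses are equal as sets, so the length of the list is the
  -- number of clauses and removing one position removes the clause altogether.
  record ClauseSet : Set where
    field
      clauses  : List Clause
      distinct : UniqueSetoid.Unique clauseSetoid clauses

  open ClauseSet public

  vars : ClauseSet → List Var
  vars F = deduplicate _≟_ (concatMap (λ C → map var (literals C)) (clauses F))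

  n : ClauseSet → ℕ
  n F = length (vars F)

  c : ClauseSet → ℕ
  c F = length (clauses F)

  -- `a ⊖ b` is the integer a - b.
  δ : ClauseSet → ℤ
  δ F = c F ⊖ n F

  ⟦_⟧ : Literal → (Var → Bool) → Bool
  ⟦ pos v ⟧ α = α v
  ⟦ neg v ⟧ α = not (α v)

  Satisfiable : List Clause → Set
  Satisfiable Cs =
    ∃ λ (α : Var → Bool) → All (λ C → Any (λ x → ⟦ x ⟧ α ≡ true) (literals C)) Cs

  Unsatisfiable : List Clause → Set
  Unsatisfiable Cs = ¬ Satisfiable Cs

  MU : Pred ClauseSet 0ℓ
  MU F = Unsatisfiable (clauses F)
       × (∀ (i : Fin (c F)) → Satisfiable (removeAt (clauses F) i))

  Hitting : Pred ClauseSet 0ℓ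
  Hitting F = ∀ {C D} → C ∈ clauses F → D ∈ clauses F → ¬ (C ≈ᶜ D) →
    ∃ λ x → x ∈ literals C × x ∈ map comp (literals D)

  UHIT : Pred ClauseSet 0ℓ
  UHIT F = Unsatisfiable (clauses F) × Hitting F

  _[δ=_] : Pred ClauseSet 0ℓ → ℕ → Pred ClauseSet 0ℓ
  (𝒞 [δ= k ]) F = 𝒞 F × δ F ≡ + k

  infix 8 _[δ=_]

-- The set { f a : a ∈ P }.
image : {A B : Set} → (A → B) → Pred A 0ℓ → Pred B 0ℓ
image f P b = ∃ λ a → P a × f a ≡ b

IsLeast : Pred ℕ 0ℓ → Pred ℕ 0ℓ
IsLeast P m = P m × (∀ {l} → P l → m ≤ l)

least : {P : Pred ℕ 0ℓ} → Decidable P → ∃ P → ∃ (IsLeast P)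
least {P} P? (m , pm) = go P? m pm
  where
  go : {P : Pred ℕ 0ℓ} → Decidable P → ∀ m → P m → ∃ (IsLeast P)
  go P? zero    pm = zero , pm , λ _ → z≤n
  go {P} P? (suc m) pm with P? zero
  ... | yes p0 = zero , p0 , λ _ → z≤n
  ... | no ¬p0 with go (λ l → P? (suc l)) m pm
  ...   | l , pl , min = suc l , pl , min′
    where
    min′ : ∀ {j} → P j → suc l ≤ j
    min′ {zero}  pj = contradiction pj ¬p0
    min′ {suc j} pj = s≤s (min pj)

1+k+1+k≤2^[1+k] : ∀ k → suc k + suc k ≤ 2 ^ suc k
1+k+1+k≤2^[1+k] zero    = ≤-refl
1+k+1+k≤2^[1+k] (suc k) = ≤-trans
  (+-mono-≤ step step)
  (≤-reflexive (cong (λ m → 2 ^ suc k + m) (sym (+-identityʳ (2 ^ suc k)))))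
  where
  step : suc (suc k) ≤ 2 ^ suc k
  step = ≤-trans (s≤s (≤-trans (m≤m+n (suc k) k) (≤-reflexive (sym (+-suc k k))))) (1+k+1+k≤2^[1+k] k)

k≤2^k∸k : ∀ k → k ≤ 2 ^ k ∸ k
k≤2^k∸k zero    = z≤n
k≤2^k∸k (suc k) = m+n≤o⇒m≤o∸n (suc k) (1+k+1+k≤2^[1+k] k)

-- Since m < 2 ^ m, the truncated subtraction is the ordinary one.
o-spec : ∀ k → ∃ (IsLeast (λ m → k ≤ 2 ^ m ∸ m))
o-spec k = least (λ m → k ≤? (2 ^ m ∸ m)) (k , k≤2^k∸k k)

o : ℕ → ℕ
o k = proj₁ (o-spec k)

{-# OPTIONS --safe #-}

-- Lower bound: the assignments witnessing that the clauses of a minimally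
-- unsatisfiable F can be removed are pairwise different on var(F), so
-- c(F) ≤ 2 ^ n(F), and o(k) ≤ n(F) is just this inequality.
-- Conversely, whenever n + 1 ≤ c ≤ 2 ^ n there is a binary tree of height n with c
-- leaves; branching on the i-th variable at every node of depth i, the paths to the
-- leaves form an unsatisfiable hitting clause-set with n variables and c clauses.
module Submission where

open import Defs
open import Data.Bool.Base using (Bool; true; false; not)
open import Data.Empty using (⊥-elim)
open import Data.Fin.Base using (Fin; zero; suc; funToFin; finToFun)
open import Data.Fin.Properties using (2↔Bool; finToFun-funToFin; injective⇒≤)
import Data.Fin.Properties as Fin
open import Data.Integer.Base using (+_; _⊖_)
open import Data.Integer.Properties using ([1+m]⊖[1+n]≡m⊖n)
open import Data.List.Base
  using (List; []; _∷_; _++_; length; map; lookup; removeAt; upTo)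
open import Data.List.Membership.Propositional using (_∈_; find; lose)
open import Data.List.Membership.Propositional.Properties
  using (∈-map⁺; ∈-map⁻; ∈-++⁺ˡ; ∈-++⁺ʳ; ∈-++⁻; ∈-concatMap⁺; ∈-concatMap⁻; ∈-lookup;
         ∈-deduplicate⁺; ∈-deduplicate⁻; ∈-upTo⁺; ∈-upTo⁻; ∈-AllPairs₂)
open import Data.List.Membership.Propositional.Properties.WithK using (unique∧set⇒bag)
import Data.List.Membership.DecPropositional as DecMembership
open import Data.List.Properties using (length-map; length-++; length-upTo)
open import Data.List.Relation.Binary.BagAndSetEquality using (∼bag⇒↭)
open import Data.List.Relation.Binary.Disjoint.Propositional using (Disjoint)
open import Data.List.Relation.Binary.Permutation.Propositional.Properties using (↭-length)
open import Data.List.Relation.Unary.All as All using (All; []; _∷_)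
open import Data.List.Relation.Unary.AllPairs as AllPairs using (AllPairs; []; _∷_)
import Data.List.Relation.Unary.AllPairs.Properties as AllPairs
open import Data.List.Relation.Unary.Any as Any using (Any; here; there)
open import Data.List.Relation.Unary.Any.Properties using (lookup-index)
open import Data.List.Relation.Unary.Unique.Propositional using (Unique)
import Data.List.Relation.Unary.Unique.Propositional.Properties as Unique
import Data.List.Relation.Unary.Unique.DecPropositional.Properties as DecUnique
open import Data.Nat.Base using (ℕ; zero; suc; _+_; _∸_; _^_; _⊓_; _≤_; _<_; _≤′_; z≤n; s≤s; s≤s⁻¹; ≤′-refl; ≤′-step)
open import Data.Nat.Properties
  using (_≤?_; ≤-refl; ≤-trans; ≤-reflexive; ≤⇒≤′; ≰⇒>; <⇒≢; n≤1+n;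
         +-comm; +-suc; +-identityʳ; +-monoˡ-≤; +-monoʳ-≤; m≤m+n; m≤n+m; m+n≤o⇒m≤o∸n; m+[n∸m]≡n; m∸n+n≡m;
         m∸n≤m; ∸-monoˡ-≤; m^n>0; m⊓n≤m; m≤n⇒m⊓n≡m; +-cancelʳ-≤)
open import Data.Product.Base using (∃; _×_; _,_; proj₁; proj₂)
open import Data.Sum.Base using (inj₁; inj₂)
open import Function.Base using (_∘_; _on_)
open import Function.Bundles using (mk⇔; module Equivalence; module Injection; module Inverse)
open import Function.Properties.Inverse using (↔-sym; ↔⇒↣)
open import Relation.Binary.Bundles using (module Setoid)
open import Level using (0ℓ)
open import Relation.Binary.Core using (Rel)
open import Relation.Binary.Definitions using (DecidableEquality; Symmetric)
open import Relation.Binary.PropositionalEquality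
  using (_≡_; _≢_; refl; sym; trans; cong; cong₂; subst; subst₂)
open import Relation.Nullary using (¬_; does; yes; no; contradiction)
open import Relation.Nullary.Decidable using (map′; dec-true; dec-false)
open import Relation.Unary using (_≐_)

-- Lists: removing a position, and counting without repetitions

module _ {A : Set} where

  lookup∈removeAt : ∀ (xs : List A) {i j} → i ≢ j → lookup xs j ∈ removeAt xs i
  lookup∈removeAt (x ∷ xs) {zero}  {zero}  i≢j = contradiction refl i≢j
  lookup∈removeAt (x ∷ xs) {zero}  {suc j} i≢j = ∈-lookup j
  lookup∈removeAt (x ∷ xs) {suc i} {zero}  i≢j = here refl
  lookup∈removeAt (x ∷ xs) {suc i} {suc j} i≢j = there (lookup∈removeAt xs (i≢j ∘ cong suc))

  removeAt⊆ : ∀ (xs : List A) i {x} → x ∈ removeAt xs i → x ∈ xs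
  removeAt⊆ (x ∷ xs) zero    p         = there p
  removeAt⊆ (x ∷ xs) (suc i) (here eq) = here eq
  removeAt⊆ (x ∷ xs) (suc i) (there p) = there (removeAt⊆ xs i p)

  -- Symmetry is needed for the entries before position `i`. Applied to distinctness, this separates
  -- a removed clause from all the remaining ones.
  AllPairs⇒All-removeAt : ∀ {R : Rel A 0ℓ} → Symmetric R → ∀ {xs} → AllPairs R xs →
                          ∀ i → All (R (lookup xs i)) (removeAt xs i)
  AllPairs⇒All-removeAt R-sym (rs ∷ rss) zero    = rs
  AllPairs⇒All-removeAt R-sym (rs ∷ rss) (suc i) =
    R-sym (All.lookup rs (∈-lookup i)) ∷ AllPairs⇒All-removeAt R-sym rss i

  unique-length : ∀ {xs ys : List A} → Unique xs → Unique ys →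
                  (∀ {x} → x ∈ xs → x ∈ ys) → (∀ {x} → x ∈ ys → x ∈ xs) →
                  length xs ≡ length ys
  unique-length xs! ys! xs⊆ys ys⊆xs =
    ↭-length (∼bag⇒↭ (unique∧set⇒bag xs! ys! (mk⇔ xs⊆ys ys⊆xs)))

-- Arithmetic of the deficiency and of `o`

m⊖n≡+k⇒m≡n+k : ∀ m n {k} → m ⊖ n ≡ + k → m ≡ n + k
m⊖n≡+k⇒m≡n+k m       zero    refl = refl
m⊖n≡+k⇒m≡n+k (suc m) (suc n) eq   =
  cong suc (m⊖n≡+k⇒m≡n+k m n (trans (sym ([1+m]⊖[1+n]≡m⊖n m n)) eq))

n+k⊖n≡+k : ∀ n k → (n + k) ⊖ n ≡ + k
n+k⊖n≡+k zero    k = refl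
n+k⊖n≡+k (suc n) k = trans ([1+m]⊖[1+n]≡m⊖n (n + k) n) (n+k⊖n≡+k n k)

n≤2^n : ∀ n → n ≤ 2 ^ n
n≤2^n n = ≤-trans (k≤2^k∸k n) (m∸n≤m (2 ^ n) n)

2^n∸n-mono : ∀ {m n} → m ≤ n → 2 ^ m ∸ m ≤ 2 ^ n ∸ n
2^n∸n-mono m≤n = go (≤⇒≤′ m≤n)
  where
  go : ∀ {m n} → m ≤′ n → 2 ^ m ∸ m ≤ 2 ^ n ∸ n
  go ≤′-refl               = ≤-refl
  go {n = suc n} (≤′-step p) = ≤-trans (go p)
    -- `2 ^ n ∸ n` is by computation `suc (2 ^ n) ∸ suc n`, so `1 + 2 ^ n ≤ 2 ^ suc n` suffices.
    (∸-monoˡ-≤ (suc n) (≤-trans (+-monoˡ-≤ (2 ^ n) (m^n>0 2 n))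
                                (+-monoʳ-≤ (2 ^ n) (m≤m+n (2 ^ n) 0))))

-- Monotonicity of `2 ^ n ∸ n` carries the defining inequality from `o k` up to `m`.
o≤m⇒m+k≤2^m : ∀ {k m} → o k ≤ m → m + k ≤ 2 ^ m
o≤m⇒m+k≤2^m {k} {m} o≤m = ≤-trans
  (+-monoʳ-≤ m (≤-trans (proj₁ (proj₂ (o-spec k))) (2^n∸n-mono o≤m)))
  (≤-reflexive (m+[n∸m]≡n (n≤2^n m)))

m+k≤2^m⇒o≤m : ∀ {k m} → m + k ≤ 2 ^ m → o k ≤ m
m+k≤2^m⇒o≤m {k} {m} m+k≤2^m = proj₂ (proj₂ (o-spec k))
  (m+n≤o⇒m≤o∸n k (subst (_≤ 2 ^ m) (+-comm m k) m+k≤2^m))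

-- Binary trees of given height and number of leaves

-- The left subtree is required to be at least as high as the right one, which keeps a maximum out
-- of the height index.
data Tree : (height leaves : ℕ) → Set where
  leaf : Tree 0 1
  node : ∀ {h h′ c c′} → h′ ≤ h → Tree h c → Tree h′ c′ → Tree (suc h) (c + c′)

perfect : ∀ h → Tree h (2 ^ h)
perfect zero    = leaf
perfect (suc h) = subst (Tree (suc h)) (cong (λ m → 2 ^ h + m) (sym (+-identityʳ (2 ^ h))))
                        (node ≤-refl (perfect h) (perfect h))

-- The left subtree gets as many leaves as possible, leaving at least one for the right.
tree : ∀ h c → suc c ≤ 2 ^ h → Tree (h ⊓ c) (suc c)
tree zero    zero    _          = leaf
tree zero    (suc c) (s≤s ())
tree (suc h) zero    _          = leaf
tree (suc h) (suc c) 2+c≤2^[1+h] with suc c ≤? 2 ^ h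
-- The left subtree takes all leaves but one; the node adds one to both arguments of the minimum.
... | yes 1+c≤2^h = subst (Tree _) (+-comm (suc c) 1) (node z≤n (tree h c 1+c≤2^h) leaf)
-- Now `h ≤ 2 ^ h ≤ c`, so the required height is `suc h`, which the perfect left subtree provides.
... | no  1+c≰2^h = subst₂ Tree (cong suc (sym (m≤n⇒m⊓n≡m (≤-trans (n≤2^n h) 2^h≤c)))) leaves
                      (node (m⊓n≤m h rest) (perfect h) (tree h rest 1+rest≤2^h))
  where
  rest = suc c ∸ 2 ^ h
  2^h≤c : 2 ^ h ≤ c
  2^h≤c = s≤s⁻¹ (≰⇒> 1+c≰2^h)
  leaves : 2 ^ h + suc rest ≡ suc (suc c)
  leaves = trans (+-suc (2 ^ h) rest) (cong suc (m+[n∸m]≡n (≤-trans 2^h≤c (n≤1+n c))))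
  1+rest≤2^h : suc rest ≤ 2 ^ h
  1+rest≤2^h = +-cancelʳ-≤ (2 ^ h) (suc rest) (2 ^ h)
    (subst₂ _≤_ (sym (trans (+-comm (suc rest) (2 ^ h)) leaves))
                (cong (λ m → 2 ^ h + m) (+-identityʳ (2 ^ h))) 2+c≤2^[1+h])

paths : ∀ {h c} → Tree h c → List (List Bool)
paths leaf         = [] ∷ []
paths (node _ l r) = map (true ∷_) (paths l) ++ map (false ∷_) (paths r)

length-paths : ∀ {h c} (t : Tree h c) → length (paths t) ≡ c
length-paths leaf         = refl
length-paths (node _ l r) = trans (length-++ (map (true ∷_) (paths l)))
  (cong₂ _+_ (trans (length-map _ (paths l)) (length-paths l))
             (trans (length-map _ (paths r)) (length-paths r)))

path-length≤height : ∀ {h c} (t : Tree h c) {bs} → bs ∈ paths t → length bs ≤ h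
path-length≤height leaf (here refl) = z≤n
path-length≤height (node h′≤h l r) bs∈ with ∈-++⁻ (map (true ∷_) (paths l)) bs∈
... | inj₁ p with _ , q , refl ← ∈-map⁻ (true ∷_) p = s≤s (path-length≤height l q)
... | inj₂ p with _ , q , refl ← ∈-map⁻ (false ∷_) p = s≤s (≤-trans (path-length≤height r q) h′≤h)

-- Always going left works, as left subtrees are the higher ones. The clause of this path will
-- contain every variable.
longest-path : ∀ {h c} (t : Tree h c) → ∃ λ bs → bs ∈ paths t × length bs ≡ h
longest-path leaf         = [] , here refl , refl
longest-path (node _ l r) with bs , bs∈ , eq ← longest-path l =
  true ∷ bs , ∈-++⁺ˡ (∈-map⁺ (true ∷_) bs∈) , cong suc eq

module _ (𝒱 : Variables) where

  open Variables 𝒱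
  open ClauseSets 𝒱

  -- Literals and variables of a clause-set

  comp-involutive : ∀ x → comp (comp x) ≡ x
  comp-involutive (pos v) = refl
  comp-involutive (neg v) = refl

  _≟ˡ_ : DecidableEquality Literal
  pos v ≟ˡ pos w = map′ (cong pos) (cong var) (v ≟ w)
  pos v ≟ˡ neg w = no λ ()
  neg v ≟ˡ pos w = no λ ()
  neg v ≟ˡ neg w = map′ (cong neg) (cong var) (v ≟ w)

  open DecMembership _≟ˡ_ using (_∈?_)

  ⟦⟧-cong : ∀ x {α β} → α (var x) ≡ β (var x) → ⟦ x ⟧ α ≡ ⟦ x ⟧ β
  ⟦⟧-cong (pos v) eq = eq
  ⟦⟧-cong (neg v) eq = cong not eq

  var∈vars : ∀ F {C x} → C ∈ clauses F → x ∈ literals C → var x ∈ vars F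
  var∈vars F C∈F x∈C =
    ∈-deduplicate⁺ _≟_ (∈-concatMap⁺ _ (lose C∈F (∈-map⁺ var x∈C)))

  vars⇒literal : ∀ F {v} → v ∈ vars F →
                 ∃ λ C → C ∈ clauses F × ∃ λ x → x ∈ literals C × v ≡ var x
  vars⇒literal F v∈
    with C , C∈F , v∈C ← find (∈-concatMap⁻ _ (∈-deduplicate⁻ _≟_ _ v∈))
    = C , C∈F , ∈-map⁻ var v∈C

  -- Unsatisfiable hitting clause-sets are minimally unsatisfiable

  -- Only negative literals are inspected: the default `false` falsifies the positive literals of
  -- `C`, and is arbitrary on variables outside `C`.
  falsifier : Clause → Var → Bool
  falsifier C v = does (neg v ∈? literals C)

  falsifier-comp : ∀ C {x} → x ∈ literals C → ⟦ comp x ⟧ (falsifier C) ≡ true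
  falsifier-comp C {pos v} x∈C = cong not (dec-false (neg v ∈? literals C)
    λ v̄∈C → consistent C (x∈C , ∈-map⁺ comp v̄∈C))
  falsifier-comp C {neg v} x∈C = dec-true (neg v ∈? literals C) x∈C

  ≉-sym : Symmetric (λ C D → ¬ (C ≈ᶜ D))
  ≉-sym {C} {D} C≉D D≈C = C≉D (Setoid.sym clauseSetoid {D} {C} D≈C)

  -- Falsifying all literals of the removed clause satisfies every other clause, since that contains
  -- the complement of one of them.
  UHIT⇒MU : ∀ {F} → UHIT F → MU F
  UHIT⇒MU {F} (unsat , hitting) = unsat , λ i → falsifier (removed i) , All.tabulate (sat i)
    where
    removed : Fin (c F) → Clause
    removed = lookup (clauses F)

    ≉removed : ∀ i {D} → D ∈ removeAt (clauses F) i → ¬ (D ≈ᶜ removed i)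
    ≉removed i {D} D∈ = ≉-sym {removed i} {D} (All.lookup
      (AllPairs⇒All-removeAt (λ {C} {D} → ≉-sym {C} {D}) (distinct F) i) D∈)

    sat : ∀ i {D} → D ∈ removeAt (clauses F) i →
          Any (λ x → ⟦ x ⟧ (falsifier (removed i)) ≡ true) (literals D)
    sat i {D} D∈
      with x , x∈D , x∈C̄ ← hitting (removeAt⊆ (clauses F) i D∈) (∈-lookup i) (≉removed i {D} D∈)
      with y , y∈C , refl ← ∈-map⁻ comp x∈C̄
      = lose x∈D (falsifier-comp (removed i) y∈C)

  -- The upper bound on the number of clauses

  -- Suppose the witnesses for removing clauses `i ≢ j` agree on the variables of `F`. The first
  -- satisfies all clauses except possibly clause `i`; the second satisfies clause `i`, hence so
  -- does the first, and `F` is satisfiable.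
  MU⇒c≤2^n : ∀ F → MU F → c F ≤ 2 ^ n F
  MU⇒c≤2^n F (unsat , removable) = injective⇒≤ {f = restriction} restriction-injective
    where
    α : Fin (c F) → Var → Bool
    α i = proj₁ (removable i)

    -- The restriction of `α i` to the variables of `F`, coded as a number with `n F` binary digits.
    restriction : Fin (c F) → Fin (2 ^ n F)
    restriction i = funToFin (λ j → Inverse.from 2↔Bool (α i (lookup (vars F) j)))

    agree : ∀ {i j} → restriction i ≡ restriction j → ∀ {v} → v ∈ vars F → α i v ≡ α j v
    agree {i} {j} eq v∈ = subst (λ v → α i v ≡ α j v) (sym (lookup-index v∈))
      (Injection.injective (↔⇒↣ (↔-sym 2↔Bool)) (trans (sym (finToFun-funToFin _ k))
        (trans (cong (λ m → finToFun m k) eq) (finToFun-funToFin _ k))))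
      where k = Any.index v∈

    satisfies : ∀ {i j} → i ≢ j → Any (λ x → ⟦ x ⟧ (α i) ≡ true) (literals (lookup (clauses F) j))
    satisfies {i} i≢j = All.lookup (proj₂ (removable i)) (lookup∈removeAt (clauses F) i≢j)

    satisfies-all : ∀ {i j} → restriction i ≡ restriction j → i ≢ j → ∀ l →
                    Any (λ x → ⟦ x ⟧ (α i) ≡ true) (literals (lookup (clauses F) l))
    satisfies-all {i} {j} eq i≢j l with i Fin.≟ l
    ... | no  i≢l  = satisfies i≢l
    ... | yes refl with x , x∈C , true≡ ← find (satisfies (i≢j ∘ sym)) =
      lose x∈C (trans (⟦⟧-cong x (agree eq (var∈vars F (∈-lookup i) x∈C))) true≡)

    restriction-injective : ∀ {i j} → restriction i ≡ restriction j → i ≡ j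
    restriction-injective {i} {j} eq with i Fin.≟ j
    ... | yes i≡j = i≡j
    ... | no  i≢j = contradiction
      (α i , All.tabulate λ C∈F →
        subst (λ C → Any (λ x → ⟦ x ⟧ (α i) ≡ true) (literals C)) (sym (lookup-index C∈F))
              (satisfies-all eq i≢j (Any.index C∈F)))
      unsat

  -- Clauses from paths

  variableAt : ℕ → Var
  variableAt = Injection.to infinite

  literal : Bool → Var → Literal
  literal true  = pos
  literal false = neg

  var-literal : ∀ b v → var (literal b v) ≡ v
  var-literal true  v = refl
  var-literal false v = refl

  -- `d` is the depth of the node where the path starts; keeping it variable allows induction over
  -- subtrees.
  literalsFrom : ℕ → List Bool → List Literal
  literalsFrom d []       = []
  literalsFrom d (b ∷ bs) = literal b (variableAt d) ∷ literalsFrom (suc d) bs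

  -- The lower bound on `i` yields `fresh`, the upper bound limits the variables of a tree by its
  -- height.
  var-literalsFrom : ∀ d bs {x} → x ∈ literalsFrom d bs →
                     ∃ λ i → d ≤ i × i < d + length bs × var x ≡ variableAt i
  var-literalsFrom d (b ∷ bs) (here refl) =
    d , ≤-refl , ≤-trans (s≤s (m≤m+n d _)) (≤-reflexive (sym (+-suc d _))) , var-literal b _
  var-literalsFrom d (b ∷ bs) (there x∈) with i , d<i , i< , eq ← var-literalsFrom (suc d) bs x∈ =
    i , ≤-trans (n≤1+n d) d<i , ≤-trans i< (≤-reflexive (sym (+-suc d _))) , eq

  variableAt∈literalsFrom : ∀ d bs {i} → i < length bs →
                            ∃ λ x → x ∈ literalsFrom d bs × var x ≡ variableAt (d + i)
  variableAt∈literalsFrom d (b ∷ bs) {zero} _ =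
    _ , here refl , trans (var-literal b _) (cong variableAt (sym (+-identityʳ d)))
  variableAt∈literalsFrom d (b ∷ bs) {suc i} (s≤s i<)
    with x , x∈ , eq ← variableAt∈literalsFrom (suc d) bs i<
    = x , there x∈ , trans eq (cong variableAt (sym (+-suc d i)))

  var-comp : ∀ x → var (comp x) ≡ var x
  var-comp (pos v) = refl
  var-comp (neg v) = refl

  comp≢ : ∀ x → comp x ≢ x
  comp≢ (pos v) ()
  comp≢ (neg v) ()

  fresh : ∀ d bs {x} → x ∈ literalsFrom (suc d) bs → var x ≢ variableAt d
  fresh d bs x∈ eq with i , d<i , _ , eq′ ← var-literalsFrom (suc d) bs x∈ =
    <⇒≢ d<i (Injection.injective infinite (trans (sym eq) eq′))

  -- A path meets each variable at most once, so complementary literals would have to be the same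
  -- entry, contradicting `comp≢`.
  literalsFrom-consistent : ∀ d bs → Disjoint (literalsFrom d bs) (map comp (literalsFrom d bs))
  literalsFrom-consistent d bs (x∈ , x∈⁻) with y , y∈ , refl ← ∈-map⁻ comp x∈⁻ = go d bs y∈ x∈
    where
    go : ∀ d bs {y} → y ∈ literalsFrom d bs → ¬ (comp y ∈ literalsFrom d bs)
    go d (b ∷ bs) {y} (here eq)   (here eq′)  = comp≢ y (trans eq′ (sym eq))
    go d (b ∷ bs) (here refl) (there q) =
      fresh d bs q (trans (var-comp (literal b _)) (var-literal b _))
    go d (b ∷ bs) {y} (there p) (here eq) =
      fresh d bs p (trans (sym (var-comp y)) (trans (cong var eq) (var-literal b _)))
    go d (b ∷ bs) (there p) (there q) = go (suc d) bs p q

  clauseOf : List Bool → Clause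
  clauseOf bs = record
    { literals   = literalsFrom 0 bs
    ; consistent = literalsFrom-consistent 0 bs
    }

  -- The unsatisfiable hitting clause-set of a tree

  -- The hitting condition without the proviso that the clauses differ, so that it also yields their
  -- distinctness.
  Clash : Rel (List Literal) 0ℓ
  Clash xs ys = ∃ λ x → x ∈ xs × comp x ∈ ys

  Clash-sym : Symmetric Clash
  Clash-sym {xs} (x , x∈xs , x̄∈ys) = comp x , x̄∈ys , subst (_∈ xs) (sym (comp-involutive x)) x∈xs

  Clash⇒≉ : ∀ {C D} → Clash (literals C) (literals D) → ¬ (C ≈ᶜ D)
  Clash⇒≉ {C} {D} (x , x∈C , x̄∈D) C≈D = consistent D
    (x̄∈D , ∈-map⁺ comp (Equivalence.to C≈D x∈C))

  -- Two paths clash in the variable of the node where they part: the left one has it positively,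
  -- the right one negatively.
  paths-clash : ∀ {h c} (t : Tree h c) d → AllPairs (Clash on literalsFrom d) (paths t)
  paths-clash leaf         d = [] ∷ []
  paths-clash (node _ l r) d = AllPairs.++⁺ (extend true l) (extend false r)
    (All.tabulate λ p → All.tabulate λ q → clash p q)
    where
    extend : ∀ b {h c} (t : Tree h c) → AllPairs (Clash on literalsFrom d) (map (b ∷_) (paths t))
    extend b t = AllPairs.map⁺ (AllPairs.map (λ (x , p , q) → x , there p , there q)
                                             (paths-clash t (suc d)))
    clash : ∀ {bs bs′} → bs ∈ map (true ∷_) (paths l) → bs′ ∈ map (false ∷_) (paths r) →
            Clash (literalsFrom d bs) (literalsFrom d bs′)
    clash p q with _ , _ , refl ← ∈-map⁻ (true ∷_) p | _ , _ , refl ← ∈-map⁻ (false ∷_) q =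
      pos (variableAt d) , here refl , here refl

  -- Descend from the root, at each node taking the edge whose literal is false under `α`.
  falsified-path : ∀ {h c} (t : Tree h c) d α →
                   ∃ λ bs → bs ∈ paths t × All (λ x → ⟦ x ⟧ α ≡ false) (literalsFrom d bs)
  falsified-path leaf         d α = [] , here refl , []
  falsified-path (node _ l r) d α with α (variableAt d) in eq
  ... | true  with bs , bs∈ , false≡ ← falsified-path r (suc d) α =
    false ∷ bs , ∈-++⁺ʳ (map (true ∷_) (paths l)) (∈-map⁺ (false ∷_) bs∈) , cong not eq ∷ false≡
  ... | false with bs , bs∈ , false≡ ← falsified-path l (suc d) α =
    true ∷ bs , ∈-++⁺ˡ (∈-map⁺ (true ∷_) bs∈) , eq ∷ false≡

  clauseSetOf : ∀ {h c} → Tree h c → ClauseSet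
  clauseSetOf t = record
    { clauses  = map clauseOf (paths t)
    ; distinct = AllPairs.map⁺ (AllPairs.map (λ {bs} {bs′} → Clash⇒≉ {clauseOf bs} {clauseOf bs′})
                                             (paths-clash t 0))
    }

  clauseSetOf-UHIT : ∀ {h c} (t : Tree h c) → UHIT (clauseSetOf t)
  clauseSetOf-UHIT t = unsat , hitting
    where
    unsat : Unsatisfiable (map clauseOf (paths t))
    unsat (α , sat)
      with bs , bs∈ , false≡ ← falsified-path t 0 α
      with x , x∈ , true≡ ← find (All.lookup sat (∈-map⁺ clauseOf bs∈))
      with () ← trans (sym true≡) (All.lookup false≡ x∈)

    toHit : ∀ {C D} → Clash (literals C) (literals D) →
            ∃ λ x → x ∈ literals C × x ∈ map comp (literals D)
    toHit {D = D} (x , x∈C , x̄∈D) =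
      x , x∈C , subst (_∈ map comp (literals D)) (comp-involutive x) (∈-map⁺ comp x̄∈D)

    hitting : Hitting (clauseSetOf t)
    hitting {C} {D} C∈ D∈ C≉D
      with ∈-AllPairs₂ {R = Clash on literals} (AllPairs.map⁺ (paths-clash t 0)) C∈ D∈
    ... | inj₁ refl         = ⊥-elim (C≉D (Setoid.refl clauseSetoid {C}))
    ... | inj₂ (inj₁ clash) = toHit {C} {D} clash
    ... | inj₂ (inj₂ clash) = toHit {C} {D} (Clash-sym clash)

  c-clauseSetOf : ∀ {h c′} (t : Tree h c′) → c (clauseSetOf t) ≡ c′
  c-clauseSetOf t = trans (length-map clauseOf (paths t)) (length-paths t)

  -- No path is longer than `h`, and a longest path uses all of the first `h` variables.
  n-clauseSetOf : ∀ {h c} (t : Tree h c) → n (clauseSetOf t) ≡ h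
  n-clauseSetOf {h} t = trans
    (unique-length (DecUnique.deduplicate-! _≟_ _)
      (Unique.map⁺ (Injection.injective infinite) (Unique.upTo⁺ h)) to from)
    (trans (length-map variableAt (upTo h)) (length-upTo h))
    where
    to : ∀ {v} → v ∈ vars (clauseSetOf t) → v ∈ map variableAt (upTo h)
    to v∈
      with C , C∈ , x , x∈C , refl ← vars⇒literal (clauseSetOf t) v∈
      with bs , bs∈ , refl ← ∈-map⁻ clauseOf C∈
      with i , _ , i< , eq ← var-literalsFrom 0 bs x∈C
      = subst (_∈ map variableAt (upTo h)) (sym eq)
          (∈-map⁺ variableAt (∈-upTo⁺ (≤-trans i< (path-length≤height t bs∈))))

    from : ∀ {v} → v ∈ map variableAt (upTo h) → v ∈ vars (clauseSetOf t)
    from v∈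
      with i , i∈ , refl ← ∈-map⁻ variableAt v∈
      with bs , bs∈ , refl ← longest-path t
      with x , x∈ , eq ← variableAt∈literalsFrom 0 bs (∈-upTo⁻ i∈)
      = subst (_∈ vars (clauseSetOf t)) eq (var∈vars (clauseSetOf t) (∈-map⁺ clauseOf bs∈) x∈)

  -- Realising all values, and the conclusion

  UHIT-exists : ∀ {k m} → 1 ≤ k → o k ≤ m →
                ∃ λ F → (UHIT [δ= k ]) F × n F ≡ m × c F ≡ m + k
  UHIT-exists {suc k} {m} _ o≤m = clauseSetOf t ,
    (clauseSetOf-UHIT t ,
      trans (cong₂ _⊖_ (c-clauseSetOf t) (n-clauseSetOf t)) (n+k⊖n≡+k m (suc k))) ,
    n-clauseSetOf t , c-clauseSetOf t
    where
    t : Tree m (m + suc k)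
    -- Positive deficiency gives at least `m + 1` leaves, so the height `m ⊓ (m + k)` is the full
    -- `m`.
    t = subst₂ Tree (m≤n⇒m⊓n≡m (m≤m+n m k)) (sym (+-suc m k))
          (tree m (m + k) (subst (_≤ 2 ^ m) (+-suc m k) (o≤m⇒m+k≤2^m o≤m)))

  MU⇒o≤n : ∀ {k F} → (MU [δ= k ]) F → o k ≤ n F × c F ≡ n F + k
  MU⇒o≤n {k} {F} (mu , δ≡k) = m+k≤2^m⇒o≤m (subst (_≤ 2 ^ n F) c≡n+k (MU⇒c≤2^n F mu)) , c≡n+k
    where
    c≡n+k : c F ≡ n F + k
    c≡n+k = m⊖n≡+k⇒m≡n+k (c F) (n F) δ≡k

theorem6p13 : (𝒱 : Variables) → let open ClauseSets 𝒱 in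
    (k : ℕ) → 1 ≤ k →
    ( image n (UHIT [δ= k ]) ≐ image n (MU [δ= k ])
    × image n (MU [δ= k ]) ≐ (λ m → o k ≤ m) )
    ×
    ( image c (UHIT [δ= k ]) ≐ image c (MU [δ= k ])
    × image c (MU [δ= k ]) ≐ (λ m → 1 ≤ m × o k + k ≤ m) )
theorem6p13 𝒱 k 1≤k =
  -- Both equalities come from one cycle of inclusions: UHIT values are MU values, these obey the
  -- bound, and all numbers within the bound are UHIT values.
  ((weaken n , exists-n ∘ bound-n) , (bound-n , weaken n ∘ exists-n)) ,
  ((weaken c , exists-c ∘ proj₂ ∘ bound-c) , (bound-c , weaken c ∘ exists-c ∘ proj₂))
  where
  open ClauseSets 𝒱

  weaken : ∀ (f : ClauseSet → ℕ) {m} → image f (UHIT [δ= k ]) m → image f (MU [δ= k ]) m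
  weaken f (F , (uhit , δ≡k) , eq) = F , (UHIT⇒MU 𝒱 {F} uhit , δ≡k) , eq

  bound-n : ∀ {m} → image n (MU [δ= k ]) m → o k ≤ m
  bound-n (F , mu , refl) = proj₁ (MU⇒o≤n 𝒱 {F = F} mu)

  bound-c : ∀ {m} → image c (MU [δ= k ]) m → 1 ≤ m × o k + k ≤ m
  bound-c (F , mu , refl) with o≤n , c≡n+k ← MU⇒o≤n 𝒱 {F = F} mu =
    subst (λ m → 1 ≤ m × o k + k ≤ m) (sym c≡n+k)
      (≤-trans 1≤k (m≤n+m k (n F)) , +-monoˡ-≤ k o≤n)

  exists-n : ∀ {m} → o k ≤ m → image n (UHIT [δ= k ]) m
  exists-n o≤m with F , uhit , n≡m , _ ← UHIT-exists 𝒱 1≤k o≤m = F , uhit , n≡m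

  exists-c : ∀ {m} → o k + k ≤ m → image c (UHIT [δ= k ]) m
  -- Take `m ∸ k` variables; nothing is truncated, because `k ≤ o k + k ≤ m`.
  exists-c {m} o+k≤m with F , uhit , _ , c≡ ← UHIT-exists 𝒱 1≤k (m+n≤o⇒m≤o∸n (o k) o+k≤m) =
    F , uhit , trans c≡ (m∸n+n≡m (≤-trans (m≤n+m k (o k)) o+k≤m))
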